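{- Let $p>1$ be an integer, and let $A(b)$, $b\in\mathcal{B}=\{1,2,\dots\}$, be the policy class of deterministic ski-rental algorithms in which the parameter $b$ is the number of renting days. The degradation factor of algorithm $A(b)$, with respect to the baseline $A(p)$, the optimal $2$-competitive algorithm, is $$\mathrm{DF}(A(b)) = \frac12 + \max\left\{\frac{p}{2b},\frac{b}{2p}\right\}.$$
   Context: Ski-rental problem: a skier goes skiing for an unknown number of days. On each day the skier can either rent skis at a unit price or buy them at a higher integer price $p>1$ and ski for free from then on. Only deterministic algorithms are considered. The algorithm $A(b)$ has $b$ as its number of renting days: it rents up to this break-even point and then buys if skiing continues. The baseline $A(p)$ is the break-even algorithm, which has the optimal competitive ratio $2$ among deterministic algorithms. The competitive ratio $\mathrm{CR}(A)$ of an online algorithm $A$ is the worst-case ratio, over all inputs, between the cost of $A$ and the cost of the offline optimal solution. Degradation factor: for a family of algorithms $A(\theta)$ parameterized by $\theta$ and a baseline algorithm $A(\theta_0)$, the degradation factor $\mathrm{DF}(A(\theta))$ is the worst-case performance degradation of $A(\theta)$ with respect to the baseline, introduced through $\mathrm{CR}(A(\theta))\le \mathrm{DF}(A(\theta))\,\mathrm{CR}(A(\theta_0))$; for the ski-rental problem it is evaluated as the ratio $\mathrm{DF}(A(b))=\mathrm{CR}(A(b))/\mathrm{CR}(A(p))$ with $\mathrm{CR}(A(p))=2$.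
   Formalization: The algorithm A(b) is charged the purchase price p as soon as its b renting days are over, even if the season ends after exactly b days; if it paid only when skiing continues for a further whole day, the formula would fail (e.g. p=2, b=1 gives 3/4, not 3/2). -}

module Defs where

open import Data.Bool.Base using (if_then_else_; true; false)
open import Data.Integer.Base using (+_)
open import Data.Nat.Base as ℕ using (ℕ; zero; suc; NonZero)
import Data.Nat.Properties as ℕ
open import Data.Product.Base using (∃; ∃₂; Σ; _×_; _,_)
open import Data.Rational.Base as ℚ using (ℚ; _/_; _÷_; _≤_)
open import Data.Sum.Base using (inj₁; inj₂)
open import Relation.Binary.PropositionalEquality.Core using (_≡_; refl)

-- A deterministic algorithm is represented by its total cost on each input;
-- an input is the number of days skied.

Algorithm : Set
Algorithm = ℕ → ℕ

-- A p b pays rent 1 for b days and buys at price p as soon as those b days are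
-- over.  The season may end right after the purchase: a season of exactly b
-- days costs b + p.  If instead the purchase were only charged when a further
-- whole day follows, the competitive ratio for b < p would be
-- (b + p) / (b + 1) and not (b + p) / b.

A : (p b : ℕ) → Algorithm
A p b days = if days ℕ.<ᵇ b then days else b ℕ.+ p

-- The offline optimum.  Knowing the number of days, one may buy after any
-- number k of renting days (k = 0: at once; k > days: never); opt is the
-- minimum of the resulting costs, by opt-≤ and opt-attained.

opt : (p days : ℕ) → ℕ
opt p days = days ℕ.⊓ p

opt-≤ : ∀ p days k → opt p days ℕ.≤ A p k days
opt-≤ p days k with days ℕ.<ᵇ k
... | true  = ℕ.m⊓n≤m days p
... | false = ℕ.≤-trans (ℕ.m⊓n≤n days p) (ℕ.m≤n+m p k)

never-buy : ∀ p days → A p (suc days) days ≡ days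
never-buy p zero       = refl
never-buy p (suc days) with days ℕ.<ᵇ suc days | ℕ.<⇒<ᵇ (ℕ.n<1+n days)
... | true | _ = refl

opt-attained : ∀ p days → ∃ λ k → A p k days ≡ opt p days
opt-attained p days with ℕ.≤-total days p
... | inj₁ days≤p rewrite ℕ.m≤n⇒m⊓n≡m days≤p = suc days , never-buy p days
... | inj₂ p≤days rewrite ℕ.m≥n⇒m⊓n≡n p≤days = 0 , refl

opt-nonZero : ∀ p days → .{{NonZero p}} → .{{NonZero days}} → NonZero (opt p days)
opt-nonZero (suc _) (suc _) = _

-- The supremum, over all inputs with at least one day, of cost / optimal cost.

IsCompetitiveRatio : (p : ℕ) → .{{NonZero p}} → Algorithm → ℚ → Set
IsCompetitiveRatio p alg r =
  (∀ days → .{{_ : NonZero days}} → ratio days ≤ r) ×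
  (∀ u → (∀ days → .{{_ : NonZero days}} → ratio days ≤ u) → r ≤ u)
  where
  ratio : (days : ℕ) → .{{NonZero days}} → ℚ
  ratio days = (+ alg days / opt p days) {{opt-nonZero p days}}

-- d = CR(family θ) / CR(family θ₀).  Competitive ratios are unique when they
-- exist, so the existential only names them.

IsDegradationFactor : (p : ℕ) → .{{NonZero p}} →
                      {Θ : Set} (family : Θ → Algorithm) (θ₀ θ : Θ) → ℚ → Set
IsDegradationFactor p family θ₀ θ d =
  ∃₂ λ r r₀ → IsCompetitiveRatio p (family θ) r ×
              IsCompetitiveRatio p (family θ₀) r₀ ×
              Σ (ℚ.NonZero r₀) λ r₀≢0 → d ≡ (r ÷ r₀) {{r₀≢0}}

{-# OPTIONS --safe #-}
module Submission where

-- The cost ratio of A(b) is largest on the season of exactly b days, where the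
-- purchase has just been made; it equals (b + p) / min(b, p) there, that is
-- 1 + max(p/b, b/p).  For b = p this is 2.

open import Defs
open import Data.Bool.Base using (true; false)
open import Data.Integer.Base using (+_)
import Data.Integer.Base as ℤ
import Data.Integer.Properties as ℤ
open import Data.Nat.Base as ℕ using (ℕ; suc; NonZero; _>_)
open import Data.Nat.Properties using (m*n≢0)
import Data.Nat.Properties as ℕ
open import Data.Product.Base using (_,_)
open import Data.Rational.Base using (ℚ; ½; _/_; _+_; _⊔_)
import Data.Rational.Base as ℚ
import Data.Rational.Properties as ℚ
import Data.Rational.Unnormalised.Base as ℚᵘ
import Data.Rational.Unnormalised.Properties as ℚᵘ
open import Data.Sum.Base using (inj₁; inj₂)
open import Relation.Binary.PropositionalEquality
  using (_≡_; refl; sym; cong; cong₂; subst; module ≡-Reasoning)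

-- `_/_` on `ℚ` cancels common factors, which blocks direct calculation. Fractions are therefore
-- compared in `ℚᵘ`, where numerator and denominator stay as written; this is the bridge.
toℚᵘ-/ : ∀ i n .{{_ : NonZero n}} → ℚ.toℚᵘ (i / n) ℚᵘ.≃ i ℚᵘ./ n
toℚᵘ-/ i (suc n) = ℚ.toℚᵘ-fromℚᵘ (ℚᵘ.mkℚᵘ i n)

/-mono-≤ : ∀ j m k n .{{_ : NonZero m}} .{{_ : NonZero n}} →
           j ℕ.* n ℕ.≤ k ℕ.* m → + j / m ℚ.≤ + k / n
/-mono-≤ j m@(suc _) k n@(suc _) jn≤km = ℚ.toℚᵘ-cancel-≤ (begin
  ℚ.toℚᵘ (+ j / m)  ≃⟨ toℚᵘ-/ (+ j) m ⟩
  + j ℚᵘ./ m        ≤⟨ ℚᵘ.*≤* (ℤ.≤-trans (ℤ.≤-reflexive (sym (ℤ.pos-* j n)))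
                                (ℤ.≤-trans (ℤ.+≤+ jn≤km) (ℤ.≤-reflexive (ℤ.pos-* k m)))) ⟩
  + k ℚᵘ./ n        ≃⟨ toℚᵘ-/ (+ k) n ⟨
  ℚ.toℚᵘ (+ k / n)  ∎)
  where open ℚᵘ.≤-Reasoning

½*/ : ∀ i n .{{_ : NonZero n}} → (i / (2 ℕ.* n)) {{m*n≢0 2 n}} ≡ ½ ℚ.* (i / n)
½*/ i n@(suc _) = ℚ.toℚᵘ-injective (begin-equality
  ℚ.toℚᵘ (i / (2 ℕ.* n))        ≃⟨ toℚᵘ-/ i (2 ℕ.* n) ⟩
  -- The product with `ℚᵘ.½` multiplies numerators and denominators separately, so only the factor 1
  -- in the numerator has to be absorbed.
  i ℚᵘ./ (2 ℕ.* n)              ≡⟨ cong (ℚᵘ._/ (2 ℕ.* n)) (ℤ.*-identityˡ i) ⟨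
  ℚᵘ.½ ℚᵘ.* (i ℚᵘ./ n)          ≃⟨ ℚᵘ.*-congˡ (toℚᵘ-/ i n) ⟨
  ℚᵘ.½ ℚᵘ.* ℚ.toℚᵘ (i / n)      ≃⟨ ℚ.toℚᵘ-homo-* ½ (i / n) ⟨
  ℚ.toℚᵘ (½ ℚ.* (i / n))        ∎)
  where open ℚᵘ.≤-Reasoning

[n+i]/n≡1+i/n : ∀ i n .{{_ : NonZero n}} → (+ n ℤ.+ i) / n ≡ ℚ.1ℚ + i / n
[n+i]/n≡1+i/n i n@(suc _) = ℚ.toℚᵘ-injective (begin-equality
  ℚ.toℚᵘ ((+ n ℤ.+ i) / n)      ≃⟨ toℚᵘ-/ (+ n ℤ.+ i) n ⟩
  (+ n ℤ.+ i) ℚᵘ./ n            ≡⟨ ℚᵘ./-cong (cong₂ ℤ._+_ (ℤ.*-identityˡ (+ n)) (ℤ.*-identityʳ i))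
                                             (ℕ.*-identityˡ n) ⟨
  ℚᵘ.1ℚᵘ ℚᵘ.+ (i ℚᵘ./ n)        ≃⟨ ℚᵘ.+-congʳ ℚᵘ.1ℚᵘ (toℚᵘ-/ i n) ⟨
  ℚᵘ.1ℚᵘ ℚᵘ.+ ℚ.toℚᵘ (i / n)    ≃⟨ ℚ.toℚᵘ-homo-+ ℚ.1ℚ (i / n) ⟨
  ℚ.toℚᵘ (ℚ.1ℚ + i / n)         ∎)
  where open ℚᵘ.≤-Reasoning

n/n≡1 : ∀ n .{{_ : NonZero n}} → + n / n ≡ ℚ.1ℚ
n/n≡1 n = ℚ.≤-antisym (/-mono-≤ n n 1 1 (ℕ.≤-reflexive (ℕ.*-comm n 1)))
                      (/-mono-≤ 1 1 n n (ℕ.≤-reflexive (ℕ.*-comm 1 n)))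

worstRatio : (p b : ℕ) → .{{NonZero p}} → .{{NonZero b}} → ℚ
worstRatio p b = (+ (b ℕ.+ p) / opt p b) {{opt-nonZero p b}}

A-break-even : ∀ p b → A p b b ≡ b ℕ.+ p
A-break-even p b with b ℕ.<ᵇ b | ℕ.<ᵇ⇒< b b
... | true  | b<b with () ← ℕ.<-irrefl refl (b<b _)
... | false | _   = refl

-- No season is worse than that of `b` days, with denominators cleared. From day `b` on the cost is
-- constant while `opt` cannot decrease; before day `b` only rent has been paid.
A-cost-≤ : ∀ p b days → A p b days ℕ.* opt p b ℕ.≤ (b ℕ.+ p) ℕ.* opt p days
A-cost-≤ p b days with days ℕ.<ᵇ b | ℕ.<ᵇ⇒< days b | ℕ.<⇒<ᵇ {days} {b}
-- In this branch `ℕ.<⇒<ᵇ` lands in the empty type, so `≮` refutes `days < b`.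
... | false | _ | ≮ =
  ℕ.*-monoʳ-≤ (b ℕ.+ p) (ℕ.⊓-monoˡ-≤ p (ℕ.≮⇒≥ ≮))
... | true | days<b | _ with ℕ.≤-total days p
-- Renting throughout is optimal here: the ratio is 1.
...   | inj₁ days≤p rewrite ℕ.m≤n⇒m⊓n≡m days≤p | ℕ.*-comm (b ℕ.+ p) days =
  ℕ.*-monoʳ-≤ days (ℕ.≤-trans (ℕ.m⊓n≤m b p) (ℕ.m≤m+n b p))
-- The optimum is `p`, and the bound holds factor by factor: `days < b ≤ b + p` and `opt p b ≤ p`.
...   | inj₂ p≤days rewrite ℕ.m≥n⇒m⊓n≡n p≤days =
  ℕ.*-mono-≤ (ℕ.≤-trans (ℕ.<⇒≤ (days<b _)) (ℕ.m≤m+n b p)) (ℕ.m⊓n≤n b p)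

worstRatio-isCompetitiveRatio : ∀ p b .{{_ : NonZero p}} .{{_ : NonZero b}} →
                                IsCompetitiveRatio p (A p b) (worstRatio p b)
worstRatio-isCompetitiveRatio p b =
  (λ days → /-mono-≤ (A p b days) (opt p days) (b ℕ.+ p) (opt p b)
    {{opt-nonZero p days}} {{opt-nonZero p b}} (A-cost-≤ p b days)) ,
  -- The bound is attained at `days = b`, hence it is the least one.
  (λ u ratio≤u → subst (λ c → (+ c / opt p b) {{opt-nonZero p b}} ℚ.≤ u) (A-break-even p b) (ratio≤u b))

-- Dividing `b + p` by the smaller of the two gives 1 plus larger over smaller, and that quotient is
-- the maximum of the two reciprocal fractions.
worstRatio≡1+⊔ : ∀ p b .{{_ : NonZero p}} .{{_ : NonZero b}} →
                 worstRatio p b ≡ ℚ.1ℚ + (+ p / b ⊔ + b / p)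
worstRatio≡1+⊔ p b with ℕ.≤-total b p
... | inj₁ b≤p = begin
  worstRatio p b                ≡⟨ ℚ./-cong {{opt-nonZero p b}} (refl {x = + (b ℕ.+ p)})
                                         (ℕ.m≤n⇒m⊓n≡m b≤p) ⟩
  + (b ℕ.+ p) / b               ≡⟨ [n+i]/n≡1+i/n (+ p) b ⟩
  ℚ.1ℚ + + p / b                ≡⟨ cong (_+_ ℚ.1ℚ)
                                     -- Cross-multiplied, `b / p ≤ p / b` reads `b * b ≤ p * p`.
                                     (ℚ.p≥q⇒p⊔q≡p (/-mono-≤ b p p b (ℕ.*-mono-≤ b≤p b≤p))) ⟨
  ℚ.1ℚ + (+ p / b ⊔ + b / p)    ∎
  where open ≡-Reasoning
... | inj₂ p≤b = begin
  worstRatio p b                ≡⟨ ℚ./-cong {{opt-nonZero p b}} (cong +_ (ℕ.+-comm b p))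
                                         (ℕ.m≥n⇒m⊓n≡n p≤b) ⟩
  + (p ℕ.+ b) / p               ≡⟨ [n+i]/n≡1+i/n (+ b) p ⟩
  ℚ.1ℚ + + b / p                ≡⟨ cong (_+_ ℚ.1ℚ)
                                     (ℚ.p≤q⇒p⊔q≡q (/-mono-≤ p b b p (ℕ.*-mono-≤ p≤b p≤b))) ⟨
  ℚ.1ℚ + (+ p / b ⊔ + b / p)    ∎
  where open ≡-Reasoning

worstRatio-diagonal : ∀ p .{{_ : NonZero p}} → worstRatio p p ≡ + 2 / 1
worstRatio-diagonal p = begin
  worstRatio p p                ≡⟨ worstRatio≡1+⊔ p p ⟩
  ℚ.1ℚ + (+ p / p ⊔ + p / p)    ≡⟨ cong (λ x → ℚ.1ℚ + (x ⊔ x)) (n/n≡1 p) ⟩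
  + 2 / 1                       ∎
  where open ≡-Reasoning

theorem2p1 : (p : ℕ) → .{{_ : NonZero p}} → p > 1 → (b : ℕ) → .{{_ : NonZero b}} →
    IsDegradationFactor p (A p) p b
    (½ + ((+ p / (2 ℕ.* b)) {{m*n≢0 2 b}} ⊔ (+ b / (2 ℕ.* p)) {{m*n≢0 2 p}}))
theorem2p1 p _ b =
  worstRatio p b , + 2 / 1 , worstRatio-isCompetitiveRatio p b ,
  subst (IsCompetitiveRatio p (A p p)) (worstRatio-diagonal p) (worstRatio-isCompetitiveRatio p p) ,
  _ , (begin
    ½ + ((+ p / (2 ℕ.* b)) {{m*n≢0 2 b}} ⊔ (+ b / (2 ℕ.* p)) {{m*n≢0 2 p}})
      ≡⟨ cong (_+_ ½) (cong₂ _⊔_ (½*/ (+ p) b) (½*/ (+ b) p)) ⟩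
    ½ + (½ ℚ.* (+ p / b) ⊔ ½ ℚ.* (+ b / p))
      ≡⟨ cong (_+_ ½) (ℚ.*-distribˡ-⊔-nonNeg ½ (+ p / b) (+ b / p)) ⟨
    -- The summand `½` is rewritten as `½ ℚ.* ℚ.1ℚ`, equal by computation, so that `½` factors out.
    ½ ℚ.* ℚ.1ℚ + ½ ℚ.* (+ p / b ⊔ + b / p)
      ≡⟨ ℚ.*-distribˡ-+ ½ ℚ.1ℚ (+ p / b ⊔ + b / p) ⟨
    ½ ℚ.* (ℚ.1ℚ + (+ p / b ⊔ + b / p))
      ≡⟨ cong (½ ℚ.*_) (worstRatio≡1+⊔ p b) ⟨
    ½ ℚ.* worstRatio p b
      -- Division by 2 computes to multiplication by `½` on the right.
      ≡⟨ ℚ.*-comm ½ (worstRatio p b) ⟩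
    worstRatio p b ℚ.÷ (+ 2 / 1)
      ∎)
  where open ≡-Reasoning
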